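{- Let $A$, $B$, $C$ be well-founded binary relations on a set $V$. Suppose that $$BA \;\subseteq\; A\,(A\cup B)^* \,\cup\, B$$ and $$C\,(A\cup B) \;\subseteq\; (A\cup B)\,(A\cup B\cup C)^* \,\cup\, C .$$ Then the union $A\cup B\cup C$ is well-founded.
   Context: A binary relation $R$ on $V$ is called well-founded if there is no infinite forward-pointing path, i.e. no infinite sequence $x_0,x_1,x_2,\dots$ of (not necessarily distinct) elements of $V$ with $x_i \mathrel{R} x_{i+1}$ for all $i\ge 0$. Juxtaposition denotes composition of relations read from left to right: $x \mathrel{(RS)} z$ iff there is $y\in V$ with $x\mathrel{R}y$ and $y\mathrel{S}z$. $R^*$ denotes the reflexive-transitive closure of $R$ (zero or more $R$-steps). Composition binds more tightly than union. -}

module Defs where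

open import Data.Nat.Base using (ℕ; suc)
open import Data.Product.Base using (∃)
open import Level using (Level; _⊔_)
open import Relation.Binary.Core using (Rel)
-- The library's name for composition is U+037E (Greek question mark), which
-- looks like a semicolon and is normalised to one by some tools.
open import Relation.Binary.Construct.Composition public
  using () renaming (_;_ to infixr 9 _⨾_)
open import Relation.Nullary.Negation.Core using (¬_)

private
  variable
    v ℓ : Level
    V : Set v

InfinitePath : Rel V ℓ → (ℕ → V) → Set ℓ
InfinitePath R x = ∀ i → R (x i) (x (suc i))

-- Paths run forwards along R, the opposite orientation to the library's
-- WellFounded. Accessibility of every point for the converse of R implies this;
-- the reverse implication is classical.
IsWellFounded : {V : Set v} → Rel V ℓ → Set (v ⊔ ℓ)
IsWellFounded R = ¬ ∃ λ x → InfinitePath R x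

{-# OPTIONS --safe #-}

-- Excluded middle, applied to untruncated existentials, supplies the choices
-- that turn absence of infinite paths into accessibility for the converse
-- relation. From there the argument is constructive. The two hypotheses are
-- instances of one condition, BA ⊆ A T* ∪ B with T ⊆ A ∪ B, which makes T
-- well-founded when A and B are; it is used first for T = A ∪ B and then, with
-- A ∪ B and C in the roles of A and B, for T = A ∪ B ∪ C.
module Submission where

open import Defs
open import Axiom.DoubleNegationElimination using (em⇒dne)
open import Axiom.ExcludedMiddle using (ExcludedMiddle)
open import Data.Nat.Base using (suc)
open import Data.Nat.GeneralisedArithmetic using (fold)
open import Data.Product.Base using (∃; _×_; _,_; proj₁; proj₂)
open import Data.Sum.Base using ([_,_]; assocˡ)
open import Function.Base using (flip; id)
open import Induction.InfiniteDescent using (descent∧wf⇒empty)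
open import Induction.WellFounded using (Acc; acc; acc-inverse; WellFounded)
open import Level using (Level; _⊔_)
open import Relation.Binary.Core using (Rel; _⇒_)
open import Relation.Binary.Construct.Closure.ReflexiveTransitive using (Star; ε; _◅_)
open import Relation.Binary.Construct.Union using (_∪_)
open import Relation.Binary.PropositionalEquality.Core using (_≡_; refl)
open import Relation.Nullary.Negation.Core using (¬_)

private
  variable
    v ℓ : Level
    V : Set v

-- Every point of an infinite path has an `R`-successor on the path, so descent forces the set of
-- its points to be empty.
wellFounded⇒isWellFounded : {R : Rel V ℓ} → WellFounded (flip R) → IsWellFounded R
wellFounded⇒isWellFounded wf (x , path) =
  descent∧wf⇒empty {P = λ y → ∃ λ i → x i ≡ y}
    (λ { (i , refl) → x (suc i) , path i , suc i , refl }) wf (x 0) (0 , refl)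

module _ (em : ExcludedMiddle (v ⊔ ℓ)) {V : Set v} {R : Rel V ℓ} where

  ¬acc⇒¬acc-successor : ∀ {x} → ¬ Acc (flip R) x → ∃ λ y → R x y × ¬ Acc (flip R) y
  ¬acc⇒¬acc-successor ¬acc[x] = em⇒dne em λ none →
    ¬acc[x] (acc λ xRy → em⇒dne em λ ¬acc[y] → none (_ , xRy , ¬acc[y]))

  isWellFounded⇒wellFounded : IsWellFounded R → WellFounded (flip R)
  isWellFounded⇒wellFounded noPath x₀ = em⇒dne em λ ¬acc[x₀] →
    let next : (∃ λ x → ¬ Acc (flip R) x) → ∃ λ x → ¬ Acc (flip R) x
        next (_ , ¬acc[x]) = let y , _ , ¬acc[y] = ¬acc⇒¬acc-successor ¬acc[x] in y , ¬acc[y]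
        -- Iterating the choice of an inaccessible successor from `x₀` traces an infinite path.
        seq = fold (x₀ , ¬acc[x₀]) next
    in noPath ((λ i → proj₁ (seq i)) ,
               λ i → proj₁ (proj₂ (¬acc⇒¬acc-successor (proj₂ (seq i)))))

acc-star : {R : Rel V ℓ} {x y : V} → Star R x y → Acc (flip R) x → Acc (flip R) y
acc-star ε            acc[x] = acc[x]
acc-star (xRz ◅ zR*y) acc[x] = acc-star zR*y (acc-inverse acc[x] xRz)

module _ {A B T : Rel V ℓ} (T⇒A∪B : T ⇒ A ∪ B)
         (wfA : WellFounded (flip A)) (wfB : WellFounded (flip B))
         (jump : (B ⨾ A) ⇒ (A ⨾ Star T) ∪ B) where

  -- When x B y A z, either z is T-reachable from an A-successor of x, or z is
  -- again a B-successor of x that lies further along A than y. So induction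
  -- along A proves all B-successors of x accessible.
  acc-from-A-successors : ∀ {x} → Acc (flip B) x →
    (∀ {y} → A x y → Acc (flip T) y) → Acc (flip T) x
  acc-from-A-successors {x} (acc recB) accA =
    acc λ xTy → [ accA , acc-B-successor (wfA _) ] (T⇒A∪B xTy)
    where
    acc-B-successor : ∀ {y} → Acc (flip A) y → B x y → Acc (flip T) y
    -- An outer induction along `B` leaves only the `A`-successors of `y` to be handled.
    acc-B-successor (acc recA) xBy = acc-from-A-successors (recB xBy) λ yAz →
      [ (λ { (_ , xAw , wT*z) → acc-star wT*z (accA xAw) })
      , acc-B-successor (recA yAz)
      ] (jump (_ , xBy , yAz))

  jumping-wellFounded : WellFounded (flip T)
  jumping-wellFounded x = go (wfA x)
    where
    go : ∀ {y} → Acc (flip A) y → Acc (flip T) y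
    -- Induction along `A` supplies the accessible `A`-successors.
    go (acc recA) = acc-from-A-successors (wfB _) λ yAz → go (recA yAz)

theorem4 : ∀ {v ℓ : Level} → ExcludedMiddle (v ⊔ ℓ) →
    {V : Set v} (A B C : Rel V ℓ) →
    IsWellFounded A → IsWellFounded B → IsWellFounded C →
    (B ⨾ A) ⇒ (A ⨾ Star (A ∪ B)) ∪ B →
    (C ⨾ (A ∪ B)) ⇒ ((A ∪ B) ⨾ Star (A ∪ B ∪ C)) ∪ C →
    IsWellFounded (A ∪ B ∪ C)
theorem4 em A B C wfA wfB wfC jumpAB jumpABC =
  wellFounded⇒isWellFounded
    -- `∪` associates to the right; `assocˡ` regroups the union as `(A ∪ B) ∪ C`.
    (jumping-wellFounded assocˡ
      (jumping-wellFounded id (wf wfA) (wf wfB) jumpAB)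
      (wf wfC) jumpABC)
  where
  wf : ∀ {R} → IsWellFounded R → WellFounded (flip R)
  wf = isWellFounded⇒wellFounded em
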